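{- Assume the setting described in the context. Let $\alpha:X\multimap\overline{F_\tau}X$ satisfy $[\nu_X,e_X]\cdot m'_X\cdot\overline{F_\tau}\alpha\le m_X\cdot\overline{F}^{*}\underline{\alpha}\cdot[\nu_X,e_X]$. Then every bisimulation on the $TF_\tau$-coalgebra $\alpha^{\bigstar}:X\to TF_\tau X$ is a bisimulation on the $TF^*$-coalgebra $\underline{\alpha}^{\divideontimes}:X\to TF^*X$.
   Context: Let $\mathsf{C}$ be a category with binary coproducts and $(T,\mu,\eta)$ a monad on $\mathsf{C}$. In the Kleisli category $\mathcal{K}l(T)$ (objects of $\mathsf{C}$; morphisms $X\multimap Y$ are $\mathsf{C}$-morphisms $X\to TY$; composition $g\cdot f=\mu_Z\circ Tg\circ f$; identity $1_X=\eta_X$) write $f^\sharp=\eta_Y\circ f$ for $f:X\to Y$ in $\mathsf{C}$; coproducts of $\mathcal{K}l(T)$ are those of $\mathsf{C}$, with coprojections $\iota^1,\iota^2$ and cotupling $[-,-]$. $\mathcal{K}l(T)$ is order-enriched (hom-sets are posets, composition monotone) and $T$ is an order saturation monad: for every $\alpha:X\multimap X$ there is $\alpha^{*}:X\multimap X$ with (a) $1\le\alpha^*$, (b) $\alpha\le\alpha^*$, (c) $\alpha^*\cdot\alpha^*\le\alpha^*$, (d) if $\beta:X\multimap X$ satisfies $1\le\beta$, $\alpha\le\beta$, $\beta\cdot\beta\le\beta$ then $\alpha^*\le\beta$, (e) for all $f:X\to Y$ in $\mathsf{C}$, $\beta:Y\multimap Y$ and $\Box\in\{\le,\ge\}$: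 $f^\sharp\cdot\alpha\mathrel{\Box}\beta\cdot f^\sharp$ implies $f^\sharp\cdot\alpha^*\mathrel{\Box}\beta^*\cdot f^\sharp$. A functor $S$ on $\mathsf{C}$ lifts to $\overline{S}$ on $\mathcal{K}l(T)$ if $\overline{S}X=SX$ and $\overline{S}(f^\sharp)=(Sf)^\sharp$; if $(\overline{S},m,e)$ is a monad on $\mathcal{K}l(T)$ then $TS$ is a monad on $\mathsf{C}$ whose Kleisli category is $\mathcal{K}l(\overline{S})$, with hom-sets $Hom_{\mathcal{K}l(T)}(X,\overline{S}Y)$ ordered as in $\mathcal{K}l(T)$. Standing assumptions: $\mathcal{K}l(T)$ has zero morphisms $0_{X,Y}$ (with $f\cdot 0=0=0\cdot g$). $F:\mathsf{C}\to\mathsf{C}$ lifts to $\overline{F}$, so $F_\tau=F+\mathcal{I}d$ lifts to $\overline{F_\tau}=\overline{F}+\mathcal{I}d$, which is a monad $(\overline{F_\tau},m',e')$ on $\mathcal{K}l(T)$ with $e'_X=\iota^2:X\multimap\overline{F}X+X$ and $m'_X=[\iota^1,id]\cdot(\overline{F}([0,id])+id):\overline{F}(\overline{F}X+X)+(\overline{F}X+X)\multimap\overline{F}X+X$. $F$ admits all free $F$-algebras, giving the free monad $F^*$ on $\mathsf{C}$; it lifts to $\overline{F}^*$ on $\mathcal{K}l(T)$ and $(\overline{F}^*,m,e)$ is the free monad over $\overline{F}$ in $\mathcal{K}l(T)$ with universal natural transformation $\nu:\overline{F}\Rightarrow\overline{F}^*$. For both $(\overline{S},m,e)=(\overline{F_\tau},m',e')$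 and $(\overline{S},m,e)=(\overline{F}^*,m,e)$, $\overline{S}$ is locally monotonic and $m_X\cdot\overline{S}[(m_X\cdot\overline{S}\alpha)^*\cdot e_X]=(m_X\cdot\overline{S}\alpha)^*$ for all $\alpha:X\multimap\overline{S}X$. For $\alpha:X\multimap\overline{F_\tau}X$ put $\alpha^{\bigstar}=(m'_X\cdot\overline{F_\tau}\alpha)^*\cdot e'_X$, and for $\beta:Y\multimap\overline{F}^*Y$ put $\beta^{\divideontimes}=(m_Y\cdot\overline{F}^*\beta)^*\cdot e_Y$ (these are saturation operators making $TF_\tau$ and $TF^*$ order saturation monads). For $\alpha:X\multimap\overline{F_\tau}X$ let $\underline{\alpha}=[\nu_X,e_X]\cdot\alpha:X\multimap\overline{F}^*X$; the order is that of $\mathcal{K}l(T)$. Bisimulation (kernel bisimulation): for an endofunctor $G$ on $\mathsf{C}$ and $G$-coalgebras $\alpha:X\to GX$, $\beta:Y\to GY$, a jointly monic span $X\xleftarrow{\pi_1}R\xrightarrow{\pi_2}Y$ is a bisimulation if there exist a $G$-coalgebra $\gamma:Z\to GZ$ and coalgebra homomorphisms $f$ from $\alpha$ to $\gamma$ and $g$ from $\beta$ to $\gamma$ (i.e. $Gf\circ\alpha=\gamma\circ f$, $Gg\circ\beta=\gamma\circ g$) such that $(R,\pi_1,\pi_2)$ is the pullback of $X\xrightarrow{f}Z\xleftarrow{g}Y$. A bisimulation on a coalgebra is a bisimulation between it and itself. -}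

module Defs where

open import Level using (Level; _⊔_) renaming (suc to lsuc)
open import Relation.Binary.PropositionalEquality
  using (_≡_; refl; sym; trans; cong; cong₂; module ≡-Reasoning)
open import Relation.Binary.Structures using (IsPartialOrder)
open import Data.Product using (Σ; _×_; _,_; proj₁; proj₂)

record Category (o ℓ : Level) : Set (lsuc (o ⊔ ℓ)) where
  infixr 9 _∘_
  infix 4 _⇒_
  field
    Obj : Set o
    _⇒_ : Obj → Obj → Set ℓ
    id  : ∀ {A} → A ⇒ A
    _∘_ : ∀ {A B C} → B ⇒ C → A ⇒ B → A ⇒ C
    identityˡ : ∀ {A B} {f : A ⇒ B} → id ∘ f ≡ f
    identityʳ : ∀ {A B} {f : A ⇒ B} → f ∘ id ≡ f
    assoc : ∀ {A B C D} {f : A ⇒ B} {g : B ⇒ C} {h : C ⇒ D} →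
            (h ∘ g) ∘ f ≡ h ∘ (g ∘ f)

module _ {o ℓ : Level} (C : Category o ℓ) where
  open Category C

  record Endofunctor : Set (o ⊔ ℓ) where
    field
      F₀ : Obj → Obj
      F₁ : ∀ {A B} → A ⇒ B → F₀ A ⇒ F₀ B
      identity : ∀ {A} → F₁ (id {A}) ≡ id
      homomorphism : ∀ {A B D} {f : A ⇒ B} {g : B ⇒ D} → F₁ (g ∘ f) ≡ F₁ g ∘ F₁ f

  record IsMonad (S₀ : Obj → Obj) (S₁ : ∀ {A B} → A ⇒ B → S₀ A ⇒ S₀ B)
                 (μ : ∀ X → S₀ (S₀ X) ⇒ S₀ X) (η : ∀ X → X ⇒ S₀ X) : Set (o ⊔ ℓ) where
    field
      identity : ∀ {A} → S₁ (id {A}) ≡ id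
      homomorphism : ∀ {A B D} {f : A ⇒ B} {g : B ⇒ D} → S₁ (g ∘ f) ≡ S₁ g ∘ S₁ f
      η-natural : ∀ {X Y} (f : X ⇒ Y) → S₁ f ∘ η X ≡ η Y ∘ f
      μ-natural : ∀ {X Y} (f : X ⇒ Y) → S₁ f ∘ μ X ≡ μ Y ∘ S₁ (S₁ f)
      μ-assoc : ∀ X → μ X ∘ S₁ (μ X) ≡ μ X ∘ μ (S₀ X)
      unitˡ : ∀ X → μ X ∘ S₁ (η X) ≡ id
      unitʳ : ∀ X → μ X ∘ η (S₀ X) ≡ id

  record Monad : Set (o ⊔ ℓ) where
    field
      T₀ : Obj → Obj
      T₁ : ∀ {A B} → A ⇒ B → T₀ A ⇒ T₀ B
      μ : ∀ X → T₀ (T₀ X) ⇒ T₀ X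
      η : ∀ X → X ⇒ T₀ X
      isMonad : IsMonad T₀ T₁ μ η
    open IsMonad isMonad public

  record Coproducts : Set (o ⊔ ℓ) where
    infixr 6 _+_
    field
      _+_ : Obj → Obj → Obj
      i₁ : ∀ {A B} → A ⇒ A + B
      i₂ : ∀ {A B} → B ⇒ A + B
      [_,_] : ∀ {A B Z} → A ⇒ Z → B ⇒ Z → A + B ⇒ Z
      inject₁ : ∀ {A B Z} {f : A ⇒ Z} {g : B ⇒ Z} → [ f , g ] ∘ i₁ ≡ f
      inject₂ : ∀ {A B Z} {f : A ⇒ Z} {g : B ⇒ Z} → [ f , g ] ∘ i₂ ≡ g
      unique : ∀ {A B Z} {f : A ⇒ Z} {g : B ⇒ Z} {h : A + B ⇒ Z} →
               h ∘ i₁ ≡ f → h ∘ i₂ ≡ g → [ f , g ] ≡ h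

    _+₁_ : ∀ {A A' B B'} → A ⇒ A' → B ⇒ B' → A + B ⇒ A' + B'
    f +₁ g = [ i₁ ∘ f , i₂ ∘ g ]

  record IsPullback {X Y Z R : Obj} (f : X ⇒ Z) (g : Y ⇒ Z)
                   (π₁ : R ⇒ X) (π₂ : R ⇒ Y) : Set (o ⊔ ℓ) where
    field
      commute : f ∘ π₁ ≡ g ∘ π₂
      universal : ∀ {W} (p : W ⇒ X) (q : W ⇒ Y) → f ∘ p ≡ g ∘ q →
                  Σ (W ⇒ R) λ u → (π₁ ∘ u ≡ p) × (π₂ ∘ u ≡ q) ×
                    (∀ (v : W ⇒ R) → π₁ ∘ v ≡ p → π₂ ∘ v ≡ q → v ≡ u)

  JointlyMonic : ∀ {X Y R : Obj} → R ⇒ X → R ⇒ Y → Set (o ⊔ ℓ)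
  JointlyMonic {R = R} π₁ π₂ = ∀ {W} (u v : W ⇒ R) → π₁ ∘ u ≡ π₁ ∘ v → π₂ ∘ u ≡ π₂ ∘ v → u ≡ v

  IsCoalgHom : (G₀ : Obj → Obj) (G₁ : ∀ {A B} → A ⇒ B → G₀ A ⇒ G₀ B)
               {X Z : Obj} → X ⇒ G₀ X → Z ⇒ G₀ Z → X ⇒ Z → Set ℓ
  IsCoalgHom G₀ G₁ α γ f = G₁ f ∘ α ≡ γ ∘ f

  IsBisimulation : (G₀ : Obj → Obj) (G₁ : ∀ {A B} → A ⇒ B → G₀ A ⇒ G₀ B)
                   {X Y R : Obj} → X ⇒ G₀ X → Y ⇒ G₀ Y → R ⇒ X → R ⇒ Y → Set (o ⊔ ℓ)
  IsBisimulation G₀ G₁ {X} {Y} α β π₁ π₂ =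
    JointlyMonic π₁ π₂ ×
    Σ Obj λ Z → Σ (Z ⇒ G₀ Z) λ γ → Σ (X ⇒ Z) λ f → Σ (Y ⇒ Z) λ g →
      IsCoalgHom G₀ G₁ α γ f × IsCoalgHom G₀ G₁ β γ g × IsPullback f g π₁ π₂

module KleisliDefs {o ℓ : Level} (C : Category o ℓ) (cp : Coproducts C) (T : Monad C) where
  open Category C
  open Coproducts cp
  open Monad T

  infix 4 _⊸_
  infixr 9 _·_

  _⊸_ : Obj → Obj → Set ℓ
  X ⊸ Y = X ⇒ T₀ Y

  _·_ : ∀ {X Y Z} → Y ⊸ Z → X ⊸ Y → X ⊸ Z
  _·_ {Z = Z} g f = μ Z ∘ T₁ g ∘ f

  1K : ∀ {X} → X ⊸ X
  1K {X} = η X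

  _♯ : ∀ {X Y} → X ⇒ Y → X ⊸ Y
  _♯ {Y = Y} f = η Y ∘ f

  ι¹ : ∀ {A B} → A ⊸ A + B
  ι¹ = i₁ ♯

  ι² : ∀ {A B} → B ⊸ A + B
  ι² = i₂ ♯

  [_,_]K : ∀ {A B Z} → A ⊸ Z → B ⊸ Z → A + B ⊸ Z
  [ f , g ]K = [ f , g ]

  _⊕_ : ∀ {A A' B B'} → A ⊸ A' → B ⊸ B' → A + B ⊸ A' + B'
  f ⊕ g = [ ι¹ · f , ι² · g ]K

  private
    open ≡-Reasoning
    idˡ : ∀ {X Y} {f : X ⊸ Y} → 1K · f ≡ f
    idˡ {X} {Y} {f} = begin
      μ Y ∘ T₁ (η Y) ∘ f   ≡⟨ sym assoc ⟩
      (μ Y ∘ T₁ (η Y)) ∘ f ≡⟨ cong (_∘ f) (unitˡ Y) ⟩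
      id ∘ f               ≡⟨ identityˡ ⟩
      f ∎

    idʳ : ∀ {X Y} {f : X ⊸ Y} → f · 1K ≡ f
    idʳ {X} {Y} {f} = begin
      μ Y ∘ T₁ f ∘ η X     ≡⟨ cong (μ Y ∘_) (η-natural f) ⟩
      μ Y ∘ η (T₀ Y) ∘ f   ≡⟨ sym assoc ⟩
      (μ Y ∘ η (T₀ Y)) ∘ f ≡⟨ cong (_∘ f) (unitʳ Y) ⟩
      id ∘ f               ≡⟨ identityˡ ⟩
      f ∎

    as : ∀ {A B Cc D} {f : A ⊸ B} {g : B ⊸ Cc} {h : Cc ⊸ D} → (h · g) · f ≡ h · (g · f)
    as {A} {B} {Cc} {D} {f} {g} {h} = begin
      μ D ∘ T₁ (μ D ∘ T₁ h ∘ g) ∘ f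
        ≡⟨ cong (λ z → μ D ∘ z ∘ f) (trans homomorphism (cong (T₁ (μ D) ∘_) homomorphism)) ⟩
      μ D ∘ (T₁ (μ D) ∘ T₁ (T₁ h) ∘ T₁ g) ∘ f
        ≡⟨ cong (μ D ∘_) assoc ⟩
      μ D ∘ T₁ (μ D) ∘ (T₁ (T₁ h) ∘ T₁ g) ∘ f
        ≡⟨ sym assoc ⟩
      (μ D ∘ T₁ (μ D)) ∘ (T₁ (T₁ h) ∘ T₁ g) ∘ f
        ≡⟨ cong (_∘ ((T₁ (T₁ h) ∘ T₁ g) ∘ f)) (μ-assoc D) ⟩
      (μ D ∘ μ (T₀ D)) ∘ (T₁ (T₁ h) ∘ T₁ g) ∘ f
        ≡⟨ assoc ⟩
      μ D ∘ μ (T₀ D) ∘ (T₁ (T₁ h) ∘ T₁ g) ∘ f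
        ≡⟨ cong (λ z → μ D ∘ μ (T₀ D) ∘ z) assoc ⟩
      μ D ∘ μ (T₀ D) ∘ T₁ (T₁ h) ∘ T₁ g ∘ f
        ≡⟨ cong (μ D ∘_) (sym assoc) ⟩
      μ D ∘ (μ (T₀ D) ∘ T₁ (T₁ h)) ∘ T₁ g ∘ f
        ≡⟨ cong (λ z → μ D ∘ z ∘ T₁ g ∘ f) (sym (μ-natural h)) ⟩
      μ D ∘ (T₁ h ∘ μ Cc) ∘ T₁ g ∘ f
        ≡⟨ cong (μ D ∘_) assoc ⟩
      μ D ∘ T₁ h ∘ μ Cc ∘ T₁ g ∘ f ∎

  Kleisli : Category o ℓ
  Kleisli = record
    { Obj = Obj ; _⇒_ = _⊸_ ; id = 1K ; _∘_ = _·_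
    ; identityˡ = idˡ ; identityʳ = idʳ ; assoc = as }

  record Lifting (S₀ : Obj → Obj) (S₁ : ∀ {A B} → A ⇒ B → S₀ A ⇒ S₀ B) : Set (o ⊔ ℓ) where
    field
      map : ∀ {A B} → A ⊸ B → S₀ A ⊸ S₀ B
      identity : ∀ {A} → map (1K {A}) ≡ 1K
      homomorphism : ∀ {A B D} {f : A ⊸ B} {g : B ⊸ D} → map (g · f) ≡ map g · map f
      lifts : ∀ {A B} (f : A ⇒ B) → map (f ♯) ≡ (S₁ f) ♯

  record OrderSaturation (r : Level) : Set (o ⊔ ℓ ⊔ lsuc r) where
    infix 4 _≤_
    field
      _≤_ : ∀ {X Y} → X ⊸ Y → X ⊸ Y → Set r
      isPartialOrder : ∀ {X Y} → IsPartialOrder (_≡_ {A = X ⊸ Y}) _≤_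
      ·-mono : ∀ {X Y Z} {f f' : X ⊸ Y} {g g' : Y ⊸ Z} → f ≤ f' → g ≤ g' → g · f ≤ g' · f'
      _* : ∀ {X} → X ⊸ X → X ⊸ X
      sat-a : ∀ {X} (α : X ⊸ X) → 1K ≤ α *
      sat-b : ∀ {X} (α : X ⊸ X) → α ≤ α *
      sat-c : ∀ {X} (α : X ⊸ X) → α * · α * ≤ α *
      sat-d : ∀ {X} (α β : X ⊸ X) → 1K ≤ β → α ≤ β → β · β ≤ β → α * ≤ β
      sat-e≤ : ∀ {X Y} (f : X ⇒ Y) (α : X ⊸ X) (β : Y ⊸ Y) →
               f ♯ · α ≤ β · f ♯ → f ♯ · α * ≤ β * · f ♯
      sat-e≥ : ∀ {X Y} (f : X ⇒ Y) (α : X ⊸ X) (β : Y ⊸ Y) →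
               β · f ♯ ≤ f ♯ · α → β * · f ♯ ≤ f ♯ · α *

  record ZeroMorphisms : Set (o ⊔ ℓ) where
    field
      0K : ∀ {X Y} → X ⊸ Y
      zeroˡ : ∀ {X Y Z} (f : Y ⊸ Z) → f · 0K {X} {Y} ≡ 0K
      zeroʳ : ∀ {X Y Z} (g : X ⊸ Y) → 0K {Y} {Z} · g ≡ 0K

  record FreeAlgebras (F : Endofunctor C) : Set (o ⊔ ℓ) where
    open Endofunctor F
    field
      carrier : Obj → Obj
      alg : ∀ X → F₀ (carrier X) ⇒ carrier X
      unit : ∀ X → X ⇒ carrier X
      extend : ∀ {X A} (a : F₀ A ⇒ A) (h : X ⇒ A) → carrier X ⇒ A
      extend-unit : ∀ {X A} (a : F₀ A ⇒ A) (h : X ⇒ A) → extend a h ∘ unit X ≡ h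
      extend-hom : ∀ {X A} (a : F₀ A ⇒ A) (h : X ⇒ A) →
                   extend a h ∘ alg X ≡ a ∘ F₁ (extend a h)
      extend-unique : ∀ {X A} (a : F₀ A ⇒ A) (h : X ⇒ A) (k : carrier X ⇒ A) →
                      k ∘ unit X ≡ h → k ∘ alg X ≡ a ∘ F₁ k → k ≡ extend a h
    F*₀ : Obj → Obj
    F*₀ = carrier
    F*₁ : ∀ {X Y} → X ⇒ Y → F*₀ X ⇒ F*₀ Y
    F*₁ {X} {Y} f = extend (alg Y) (unit Y ∘ f)

  module _ {r : Level} (O : OrderSaturation r) where
    open OrderSaturation O
    record SatCompatible (S₀ : Obj → Obj) (S₁ : ∀ {A B} → A ⊸ B → S₀ A ⊸ S₀ B)
                         (m : ∀ X → S₀ (S₀ X) ⊸ S₀ X) (e : ∀ X → X ⊸ S₀ X) : Set (o ⊔ ℓ ⊔ r) where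
      field
        locally-monotonic : ∀ {A B} {f g : A ⊸ B} → f ≤ g → S₁ f ≤ S₁ g
        saturation-eq : ∀ {X} (α : X ⊸ S₀ X) →
                        m X · S₁ ((m X · S₁ α) * · e X) ≡ (m X · S₁ α) *

  record IsKlMonadMorphism {S₀ S₀' : Obj → Obj}
      (S₁ : ∀ {A B} → A ⊸ B → S₀ A ⊸ S₀ B) (m : ∀ X → S₀ (S₀ X) ⊸ S₀ X) (e : ∀ X → X ⊸ S₀ X)
      (S₁' : ∀ {A B} → A ⊸ B → S₀' A ⊸ S₀' B) (m' : ∀ X → S₀' (S₀' X) ⊸ S₀' X) (e' : ∀ X → X ⊸ S₀' X)
      (φ : ∀ X → S₀ X ⊸ S₀' X) : Set (o ⊔ ℓ) where
    field
      natural : ∀ {X Y} (f : X ⊸ Y) → φ Y · S₁ f ≡ S₁' f · φ X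
      unit : ∀ X → φ X · e X ≡ e' X
      mult : ∀ X → φ X · m X ≡ m' X · S₁' (φ X) · φ (S₀ X)

record Setting (o ℓ r : Level) : Set (lsuc (o ⊔ ℓ ⊔ r)) where
  field
    C : Category o ℓ
    cp : Coproducts C
    T : Monad C
  open Category C public
  open Coproducts cp public
  open Monad T public
  open KleisliDefs C cp T public
  field
    O : OrderSaturation r
    Z : ZeroMorphisms
  open OrderSaturation O public
  open ZeroMorphisms Z public
  field
    F : Endofunctor C
    F̄ : Lifting (Endofunctor.F₀ F) (Endofunctor.F₁ F)
  open Endofunctor F public
  module F̄ = Lifting F̄

  Fτ₀ : Obj → Obj
  Fτ₀ X = F₀ X + X

  F̄τ₁ : ∀ {A B} → A ⊸ B → Fτ₀ A ⊸ Fτ₀ B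
  F̄τ₁ f = F̄.map f ⊕ f

  e' : ∀ X → X ⊸ Fτ₀ X
  e' X = ι²

  m' : ∀ X → Fτ₀ (Fτ₀ X) ⊸ Fτ₀ X
  m' X = [ ι¹ , 1K ]K · (F̄.map [ 0K , 1K ]K ⊕ 1K)

  field
    F̄τ-monad : IsMonad Kleisli Fτ₀ F̄τ₁ m' e'
    F̄τ-sat : SatCompatible O Fτ₀ F̄τ₁ m' e'
    free : FreeAlgebras F
  open FreeAlgebras free public using (F*₀; F*₁)
  field
    F̄* : Lifting F*₀ F*₁
  module F̄* = Lifting F̄*
  field
    m : ∀ X → F*₀ (F*₀ X) ⊸ F*₀ X
    e : ∀ X → X ⊸ F*₀ X
    ν : ∀ X → F₀ X ⊸ F*₀ X
    F̄*-monad : IsMonad Kleisli F*₀ F̄*.map m e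
    ν-natural : ∀ {X Y} (f : X ⊸ Y) → F̄*.map f · ν X ≡ ν Y · F̄.map f
    F̄*-free : ∀ (S₀ : Obj → Obj) (S₁ : ∀ {A B} → A ⊸ B → S₀ A ⊸ S₀ B)
                (mS : ∀ X → S₀ (S₀ X) ⊸ S₀ X) (eS : ∀ X → X ⊸ S₀ X) →
                IsMonad Kleisli S₀ S₁ mS eS →
                (σ : ∀ X → F₀ X ⊸ S₀ X) → (∀ {X Y} (f : X ⊸ Y) → S₁ f · σ X ≡ σ Y · F̄.map f) →
                Σ (∀ X → F*₀ X ⊸ S₀ X) λ φ →
                  IsKlMonadMorphism F̄*.map m e S₁ mS eS φ × (∀ X → φ X · ν X ≡ σ X) ×
                  (∀ (ψ : ∀ X → F*₀ X ⊸ S₀ X) → IsKlMonadMorphism F̄*.map m e S₁ mS eS ψ →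
                     (∀ X → ψ X · ν X ≡ σ X) → ∀ X → ψ X ≡ φ X)
    F̄*-sat : SatCompatible O F*₀ F̄*.map m e

  _★ : ∀ {X} → X ⊸ Fτ₀ X → X ⊸ Fτ₀ X
  _★ {X} α = (m' X · F̄τ₁ α) * · e' X

  _⊛ : ∀ {Y} → Y ⊸ F*₀ Y → Y ⊸ F*₀ Y
  _⊛ {Y} β = (m Y · F̄*.map β) * · e Y

  under : ∀ {X} → X ⊸ Fτ₀ X → X ⊸ F*₀ X
  under {X} α = [ ν X , e X ]K · α

  TFτ₀ : Obj → Obj
  TFτ₀ X = T₀ (Fτ₀ X)
  TFτ₁ : ∀ {A B} → A ⇒ B → TFτ₀ A ⇒ TFτ₀ B
  TFτ₁ f = T₁ (F₁ f +₁ f)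

  TF*₀ : Obj → Obj
  TF*₀ X = T₀ (F*₀ X)
  TF*₁ : ∀ {A B} → A ⇒ B → TF*₀ A ⇒ TF*₀ B
  TF*₁ f = T₁ (F*₁ f)

{-# OPTIONS --safe #-}

-- A homomorphism f from α★ to γ is one from α̲★ to γ̲, hence, by (e), from (α̲★)⊛
-- to γ̲⊛, where x̲ = [ν,e] · x. So it suffices that (α̲★)⊛ = α̲⊛, which reduces to
-- [ν,e] · A* ≤ B* · [ν,e] for A = m' · F̄τ α and B = m · F̄* α̲; the hypothesis says
-- [ν,e] · A ≤ B · [ν,e].
--
-- Property (e) does not apply directly, because ν and e need not be of the form f♯.
-- However, C → Kl(T) is a left adjoint and F̄ lifts F, so the free F-algebras of C are
-- also free F̄-algebras in Kl(T). By uniqueness of free monads there is an invertible ψ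
-- in Kl(T) with [ν,e] = ψ · κ♯, and conjugation by ψ preserves saturation by (d).
module Submission where

open import Level using (Level; _⊔_)
open import Relation.Binary.PropositionalEquality using (_≡_; sym; trans; cong; cong₂; subst; module ≡-Reasoning)
open import Relation.Binary.Bundles using (Poset)
open import Relation.Binary.Structures using (IsPartialOrder)
import Relation.Binary.Reasoning.PartialOrder as PosetReasoning
open import Data.Product using (_,_; proj₁; proj₂)
open import Defs

-- Rewriting inside composites

module CategoryProperties {o ℓ : Level} (K : Category o ℓ) where
  open Category K

  pullˡ : ∀ {A B D E} {f : D ⇒ E} {g : B ⇒ D} {h : B ⇒ E} {k : A ⇒ B} →
          f ∘ g ≡ h → f ∘ g ∘ k ≡ h ∘ k
  pullˡ p = trans (sym assoc) (cong (_∘ _) p)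

  pullʳ : ∀ {A B D E} {f : D ⇒ E} {g : B ⇒ D} {k : A ⇒ B} {h : A ⇒ D} →
          g ∘ k ≡ h → (f ∘ g) ∘ k ≡ f ∘ h
  pullʳ p = trans assoc (cong (_ ∘_) p)

  extendˡ : ∀ {A B D D' E} {f : D ⇒ E} {g : B ⇒ D} {f' : D' ⇒ E} {g' : B ⇒ D'} {k : A ⇒ B} →
            f ∘ g ≡ f' ∘ g' → f ∘ g ∘ k ≡ f' ∘ g' ∘ k
  extendˡ p = trans (pullˡ p) assoc

-- Free algebras over an arbitrary category and the free monad they form

record FreeAlgebraStructure {o ℓ : Level} (K : Category o ℓ) (G : Endofunctor K) : Set (o ⊔ ℓ) where
  open Category K
  open Endofunctor G
  field
    carrier : Obj → Obj
    alg : ∀ X → F₀ (carrier X) ⇒ carrier X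
    unit : ∀ X → X ⇒ carrier X
    extend : ∀ {X A} (a : F₀ A ⇒ A) (h : X ⇒ A) → carrier X ⇒ A
    extend-unit : ∀ {X A} (a : F₀ A ⇒ A) (h : X ⇒ A) → extend a h ∘ unit X ≡ h
    extend-hom : ∀ {X A} (a : F₀ A ⇒ A) (h : X ⇒ A) →
                 extend a h ∘ alg X ≡ a ∘ F₁ (extend a h)
    extend-unique : ∀ {X A} (a : F₀ A ⇒ A) (h : X ⇒ A) (k : carrier X ⇒ A) →
                    k ∘ unit X ≡ h → k ∘ alg X ≡ a ∘ F₁ k → k ≡ extend a h

module FreeMonad {o ℓ : Level} {K : Category o ℓ} {G : Endofunctor K}
                 (free : FreeAlgebraStructure K G) where
  open Category K
  open Endofunctor G renaming (F₀ to G₀; F₁ to G₁; identity to G-identity; homomorphism to G-homomorphism)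
  open FreeAlgebraStructure free
  open CategoryProperties K
  open ≡-Reasoning

  map : ∀ {X Y} → X ⇒ Y → carrier X ⇒ carrier Y
  map {Y = Y} f = extend (alg Y) (unit Y ∘ f)

  mult : ∀ X → carrier (carrier X) ⇒ carrier X
  mult X = extend (alg X) id

  embed : ∀ X → G₀ X ⇒ carrier X
  embed X = alg X ∘ G₁ (unit X)

  -- A homomorphism after an extension is again a homomorphism out of the free algebra, hence fixed
  -- by its values on generators. The monad laws and `⟦⟧-mult` rest on this.
  extend-fusion : ∀ {X A B} {a : G₀ A ⇒ A} {b : G₀ B ⇒ B} {h : X ⇒ A} (q : A ⇒ B) →
                  q ∘ a ≡ b ∘ G₁ q → q ∘ extend a h ≡ extend b (q ∘ h)
  extend-fusion {X} {a = a} {b} {h} q q-hom = extend-unique b (q ∘ h) (q ∘ extend a h)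
    (pullʳ (extend-unit a h))
    (begin
      (q ∘ extend a h) ∘ alg X    ≡⟨ pullʳ (extend-hom a h) ⟩
      q ∘ a ∘ G₁ (extend a h)     ≡⟨ extendˡ q-hom ⟩
      b ∘ G₁ q ∘ G₁ (extend a h)  ≡⟨ cong (b ∘_) G-homomorphism ⟨
      b ∘ G₁ (q ∘ extend a h)     ∎)

  extend-map : ∀ {X Y A} (a : G₀ A ⇒ A) (h : Y ⇒ A) (f : X ⇒ Y) →
               extend a h ∘ map f ≡ extend a (h ∘ f)
  extend-map a h f = trans (extend-fusion (extend a h) (extend-hom a h))
    (cong (extend a) (pullˡ (extend-unit a h)))

  extend-alg-unit : ∀ X → extend (alg X) (unit X) ≡ id
  extend-alg-unit X = sym (extend-unique (alg X) (unit X) id identityˡ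
    (trans identityˡ (sym (trans (cong (alg X ∘_) G-identity) identityʳ))))

  isMonad : IsMonad K carrier map mult unit
  isMonad = record
    { identity = trans (cong (extend _) identityʳ) (extend-alg-unit _)
    ; homomorphism = λ {_} {_} {_} {f} {g} → sym (trans (extend-map _ _ f) (cong (extend _) assoc))
    ; η-natural = λ f → extend-unit _ _
    ; μ-natural = λ f → trans (extend-fusion (map f) (extend-hom _ _))
        (trans (cong (extend _) (trans identityʳ (sym identityˡ))) (sym (extend-map _ id (map f))))
    ; μ-assoc = λ X → trans (extend-map _ id (mult X))
        (trans (cong (extend _) (trans identityˡ (sym identityʳ)))
          (sym (extend-fusion (mult X) (extend-hom _ _))))
    ; unitˡ = λ X → trans (extend-map _ id (unit X))
        (trans (cong (extend _) identityˡ) (extend-alg-unit X))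
    ; unitʳ = λ X → extend-unit _ _
    }

  embed-natural : ∀ {X Y} (f : X ⇒ Y) → map f ∘ embed X ≡ embed Y ∘ G₁ f
  embed-natural {X} {Y} f = begin
    map f ∘ alg X ∘ G₁ (unit X)       ≡⟨ extendˡ (extend-hom _ _) ⟩
    alg Y ∘ G₁ (map f) ∘ G₁ (unit X)  ≡⟨ cong (alg Y ∘_) G-homomorphism ⟨
    alg Y ∘ G₁ (map f ∘ unit X)       ≡⟨ cong (λ z → alg Y ∘ G₁ z) (extend-unit _ _) ⟩
    alg Y ∘ G₁ (unit Y ∘ f)           ≡⟨ cong (alg Y ∘_) G-homomorphism ⟩
    alg Y ∘ G₁ (unit Y) ∘ G₁ f        ≡⟨ assoc ⟨
    embed Y ∘ G₁ f                    ∎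

  -- Recovers the free algebra structure from the monad and `embed`; `φ-⟦⟧` uses it to recognise a
  -- homomorphism into `alg X`.
  mult-embed : ∀ X → mult X ∘ embed (carrier X) ≡ alg X
  mult-embed X = begin
    mult X ∘ alg (carrier X) ∘ G₁ (unit (carrier X))   ≡⟨ extendˡ (extend-hom _ _) ⟩
    alg X ∘ G₁ (mult X) ∘ G₁ (unit (carrier X))        ≡⟨ cong (alg X ∘_) G-homomorphism ⟨
    alg X ∘ G₁ (mult X ∘ unit (carrier X))             ≡⟨ cong (λ z → alg X ∘ G₁ z) (extend-unit _ _) ⟩
    alg X ∘ G₁ id                                      ≡⟨ cong (alg X ∘_) G-identity ⟩
    alg X ∘ id                                         ≡⟨ identityʳ ⟩
    alg X                                              ∎

  module Interpretation
    {S₀ : Obj → Obj} {S₁ : ∀ {A B} → A ⇒ B → S₀ A ⇒ S₀ B}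
    {m : ∀ X → S₀ (S₀ X) ⇒ S₀ X} {e : ∀ X → X ⇒ S₀ X} (S-monad : IsMonad K S₀ S₁ m e)
    (σ : ∀ X → G₀ X ⇒ S₀ X) (σ-natural : ∀ {X Y} (f : X ⇒ Y) → S₁ f ∘ σ X ≡ σ Y ∘ G₁ f) where
    module S = IsMonad S-monad

    -- Operations are interpreted through `σ` and the result is multiplied out. Extending `e X`
    -- along this algebra gives the induced monad morphism `⟦_⟧`.
    action : ∀ X → G₀ (S₀ X) ⇒ S₀ X
    action X = m X ∘ σ (S₀ X)

    ⟦_⟧ : ∀ X → carrier X ⇒ S₀ X
    ⟦ X ⟧ = extend (action X) (e X)

    map-action : ∀ {X Y} (f : X ⇒ Y) → S₁ f ∘ action X ≡ action Y ∘ G₁ (S₁ f)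
    map-action {X} {Y} f = begin
      S₁ f ∘ m X ∘ σ (S₀ X)        ≡⟨ extendˡ (S.μ-natural f) ⟩
      m Y ∘ S₁ (S₁ f) ∘ σ (S₀ X)   ≡⟨ cong (m Y ∘_) (σ-natural (S₁ f)) ⟩
      m Y ∘ σ (S₀ Y) ∘ G₁ (S₁ f)   ≡⟨ assoc ⟨
      action Y ∘ G₁ (S₁ f)         ∎

    mult-action : ∀ X → m X ∘ action (S₀ X) ≡ action X ∘ G₁ (m X)
    mult-action X = begin
      m X ∘ m (S₀ X) ∘ σ (S₀ (S₀ X))  ≡⟨ extendˡ (sym (S.μ-assoc X)) ⟩
      m X ∘ S₁ (m X) ∘ σ (S₀ (S₀ X))  ≡⟨ cong (m X ∘_) (σ-natural (m X)) ⟩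
      m X ∘ σ (S₀ X) ∘ G₁ (m X)       ≡⟨ assoc ⟨
      action X ∘ G₁ (m X)             ∎

    action-unit : ∀ X → action X ∘ G₁ (e X) ≡ σ X
    action-unit X = begin
      (m X ∘ σ (S₀ X)) ∘ G₁ (e X)  ≡⟨ pullʳ (sym (σ-natural (e X))) ⟩
      m X ∘ S₁ (e X) ∘ σ X         ≡⟨ pullˡ (S.unitˡ X) ⟩
      id ∘ σ X                     ≡⟨ identityˡ ⟩
      σ X                          ∎

    ⟦⟧-unit : ∀ X → ⟦ X ⟧ ∘ unit X ≡ e X
    ⟦⟧-unit X = extend-unit _ _

    ⟦⟧-embed : ∀ X → ⟦ X ⟧ ∘ embed X ≡ σ X
    ⟦⟧-embed X = begin
      ⟦ X ⟧ ∘ alg X ∘ G₁ (unit X)         ≡⟨ extendˡ (extend-hom _ _) ⟩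
      action X ∘ G₁ ⟦ X ⟧ ∘ G₁ (unit X)   ≡⟨ cong (action X ∘_) G-homomorphism ⟨
      action X ∘ G₁ (⟦ X ⟧ ∘ unit X)      ≡⟨ cong (λ z → action X ∘ G₁ z) (⟦⟧-unit X) ⟩
      action X ∘ G₁ (e X)                 ≡⟨ action-unit X ⟩
      σ X                                 ∎

    ⟦⟧-natural : ∀ {X Y} (f : X ⇒ Y) → ⟦ Y ⟧ ∘ map f ≡ S₁ f ∘ ⟦ X ⟧
    ⟦⟧-natural {X} {Y} f = begin
      ⟦ Y ⟧ ∘ map f                       ≡⟨ extend-map _ _ f ⟩
      extend (action Y) (e Y ∘ f)         ≡⟨ cong (extend _) (S.η-natural f) ⟨
      extend (action Y) (S₁ f ∘ e X)      ≡⟨ extend-fusion (S₁ f) (map-action f) ⟨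
      S₁ f ∘ ⟦ X ⟧                        ∎

    -- Both sides are homomorphisms from a free algebra to `action X`, the right one by
    -- `mult-action` and `map-action`. On generators both give `⟦ X ⟧`, by naturality of `e` and a
    -- unit law.
    ⟦⟧-mult : ∀ X → ⟦ X ⟧ ∘ mult X ≡ m X ∘ S₁ ⟦ X ⟧ ∘ ⟦ carrier X ⟧
    ⟦⟧-mult X = begin
      ⟦ X ⟧ ∘ mult X
        ≡⟨ extend-fusion ⟦ X ⟧ (extend-hom _ _) ⟩
      extend (action X) (⟦ X ⟧ ∘ id)
        ≡⟨ cong (extend _) multiplication-unit ⟨
      extend (action X) (m X ∘ S₁ ⟦ X ⟧ ∘ e (carrier X))
        ≡⟨ extend-fusion (m X) (mult-action X) ⟨
      m X ∘ extend (action (S₀ X)) (S₁ ⟦ X ⟧ ∘ e (carrier X))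
        ≡⟨ cong (m X ∘_) (extend-fusion (S₁ ⟦ X ⟧) (map-action ⟦ X ⟧)) ⟨
      m X ∘ S₁ ⟦ X ⟧ ∘ ⟦ carrier X ⟧ ∎
      where
      multiplication-unit : m X ∘ S₁ ⟦ X ⟧ ∘ e (carrier X) ≡ ⟦ X ⟧ ∘ id
      multiplication-unit = begin
        m X ∘ S₁ ⟦ X ⟧ ∘ e (carrier X)  ≡⟨ cong (m X ∘_) (S.η-natural ⟦ X ⟧) ⟩
        m X ∘ e (S₀ X) ∘ ⟦ X ⟧          ≡⟨ pullˡ (S.unitʳ X) ⟩
        id ∘ ⟦ X ⟧                      ≡⟨ identityˡ ⟩
        ⟦ X ⟧                           ≡⟨ identityʳ ⟨
        ⟦ X ⟧ ∘ id                      ∎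

-- Kleisli category: pure morphisms and cotupling

module KleisliProperties {o ℓ : Level} (C : Category o ℓ) (cp : Coproducts C) (T : Monad C) where
  open Category C
  open Coproducts cp
  open Monad T
  open KleisliDefs C cp T
  open ≡-Reasoning
  private
    module C′ = CategoryProperties C
    module Kl = Category Kleisli
    module Kl′ = CategoryProperties Kleisli

  -- Together with `♯-·`, this translates between coalgebra homomorphisms in `C` and Kleisli
  -- equations.
  ·-♯ : ∀ {X Y Z} (g : Y ⊸ Z) (f : X ⇒ Y) → g · f ♯ ≡ g ∘ f
  ·-♯ {X} {Y} {Z} g f = begin
    μ Z ∘ T₁ g ∘ η Y ∘ f     ≡⟨ cong (μ Z ∘_) (C′.extendˡ (η-natural g)) ⟩
    μ Z ∘ η (T₀ Z) ∘ g ∘ f   ≡⟨ C′.pullˡ (unitʳ Z) ⟩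
    id ∘ g ∘ f               ≡⟨ identityˡ ⟩
    g ∘ f                    ∎

  ♯-· : ∀ {X Y Z} (g : Y ⇒ Z) (f : X ⊸ Y) → g ♯ · f ≡ T₁ g ∘ f
  ♯-· {X} {Y} {Z} g f = begin
    μ Z ∘ T₁ (η Z ∘ g) ∘ f         ≡⟨ cong (λ z → μ Z ∘ z ∘ f) homomorphism ⟩
    μ Z ∘ (T₁ (η Z) ∘ T₁ g) ∘ f    ≡⟨ C′.pullˡ (C′.pullˡ (unitˡ Z)) ⟩
    (id ∘ T₁ g) ∘ f                ≡⟨ cong (_∘ f) identityˡ ⟩
    T₁ g ∘ f                       ∎

  ·-cotuple : ∀ {A B Y Z} (h : Y ⊸ Z) (f : A ⊸ Y) (g : B ⊸ Y) →
              h · [ f , g ]K ≡ [ h · f , h · g ]K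
  ·-cotuple h f g = sym (unique
    (C′.pullʳ (C′.pullʳ inject₁))
    (C′.pullʳ (C′.pullʳ inject₂)))

  cotuple-ι¹ : ∀ {A B Z} (f : A ⊸ Z) (g : B ⊸ Z) → [ f , g ]K · ι¹ ≡ f
  cotuple-ι¹ f g = trans (·-♯ _ _) inject₁

  cotuple-ι² : ∀ {A B Z} (f : A ⊸ Z) (g : B ⊸ Z) → [ f , g ]K · ι² ≡ g
  cotuple-ι² f g = trans (·-♯ _ _) inject₂

  cotuple-⊕ : ∀ {A A' B B' Z} (h : A' ⊸ Z) (k : B' ⊸ Z) (f : A ⊸ A') (g : B ⊸ B') →
              [ h , k ]K · (f ⊕ g) ≡ [ h · f , k · g ]K
  cotuple-⊕ h k f g = trans (·-cotuple _ _ _)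
    (cong₂ [_,_] (Kl′.pullˡ (cotuple-ι¹ h k)) (Kl′.pullˡ (cotuple-ι² h k)))

  ♯-⊕-♯ : ∀ {A A' B B'} (f : A ⇒ A') (g : B ⇒ B') → (f ♯) ⊕ (g ♯) ≡ (f +₁ g) ♯
  ♯-⊕-♯ f g = unique (component inject₁) (component inject₂)
    where
    component : ∀ {A B D E} {h : B ⇒ D} {i : A ⇒ B} {j : E ⇒ D} {k : A ⇒ E} →
                h ∘ i ≡ j ∘ k → (h ♯) ∘ i ≡ j ♯ · k ♯
    component p = trans (C′.pullʳ p) (trans (sym assoc) (sym (·-♯ _ _)))

  -- Free algebras carried along the Kleisli adjunction

  module LiftedFreeAlgebras {F : Endofunctor C} (F̄ : Lifting (Endofunctor.F₀ F) (Endofunctor.F₁ F))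
                            (free : FreeAlgebras F) where
    open Endofunctor F using (F₀; F₁)
    open FreeAlgebras free
    private module F̄ = Lifting F̄

    F̄-functor : Endofunctor Kleisli
    F̄-functor = record
      { F₀ = F₀ ; F₁ = F̄.map ; identity = F̄.identity ; homomorphism = F̄.homomorphism }

    -- The identity of T₀ A, read as a Kleisli morphism, is the counit of C ⇄ Kl(T).
    counit : ∀ A → T₀ A ⊸ A
    counit A = id

    -- The right adjoint of the Kleisli adjunction acting on algebras: an `F̄`-algebra on `A`
    -- becomes an `F`-algebra on `T₀ A`.
    transpose : ∀ {A} → F₀ A ⊸ A → F₀ (T₀ A) ⇒ T₀ A
    transpose {A} a = a · F̄.map (counit A)

    -- Holds because `F̄` lifts `F` and `counit A · g ♯` is `g`. Homomorphism squares for
    -- `transpose a` in `C` thereby become those for `a` in the Kleisli category.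
    transpose-F₁ : ∀ {A B} (a : F₀ A ⊸ A) (g : B ⊸ A) → transpose a ∘ F₁ g ≡ a · F̄.map g
    transpose-F₁ {A} {B} a g = begin
      (a · F̄.map (counit A)) ∘ F₁ g           ≡⟨ ·-♯ _ _ ⟨
      (a · F̄.map (counit A)) · (F₁ g) ♯       ≡⟨ cong ((a · F̄.map (counit A)) ·_) (F̄.lifts g) ⟨
      (a · F̄.map (counit A)) · F̄.map (g ♯)    ≡⟨ Kl′.pullʳ (sym F̄.homomorphism) ⟩
      a · F̄.map (counit A · g ♯)              ≡⟨ cong (λ z → a · F̄.map z) (trans (·-♯ _ _) identityˡ) ⟩
      a · F̄.map g                             ∎

    -- A Kleisli morphism into `A` is a morphism of `C` into `T₀ A`, so extending along
    -- `transpose a` serves, and uniqueness carries over by `transpose-F₁`.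
    kleisli-free : FreeAlgebraStructure Kleisli F̄-functor
    kleisli-free = record
      { carrier = carrier
      ; alg = λ X → alg X ♯
      ; unit = λ X → unit X ♯
      ; extend = λ a h → extend (transpose a) h
      ; extend-unit = λ a h → trans (·-♯ _ _) (extend-unit _ _)
      ; extend-hom = λ a h → trans (·-♯ _ _) (trans (extend-hom _ _) (transpose-F₁ a _))
      ; extend-unique = λ a h k p q → extend-unique (transpose a) h k
          (trans (sym (·-♯ _ _)) p)
          (trans (sym (·-♯ _ _)) (trans q (sym (transpose-F₁ a k))))
      }

  -- Identity and composite monad morphisms

  idMorphism : ∀ {S₀ : Obj → Obj} {S₁ : ∀ {A B} → A ⊸ B → S₀ A ⊸ S₀ B}
    {m : ∀ X → S₀ (S₀ X) ⊸ S₀ X} {e : ∀ X → X ⊸ S₀ X} → IsMonad Kleisli S₀ S₁ m e →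
    IsKlMonadMorphism S₁ m e S₁ m e (λ X → 1K)
  idMorphism {m = m} S-monad = record
    { natural = λ f → trans Kl.identityˡ (sym Kl.identityʳ)
    ; unit = λ X → Kl.identityˡ
    ; mult = λ X → trans Kl.identityˡ (sym (trans (cong (m X ·_) (trans Kl.identityʳ (IsMonad.identity S-monad))) Kl.identityʳ))
    }

  compMorphism : ∀ {S₀ S₀' S₀'' : Obj → Obj}
    {S₁ : ∀ {A B} → A ⊸ B → S₀ A ⊸ S₀ B} {m : ∀ X → S₀ (S₀ X) ⊸ S₀ X} {e : ∀ X → X ⊸ S₀ X}
    {S₁' : ∀ {A B} → A ⊸ B → S₀' A ⊸ S₀' B} {m' : ∀ X → S₀' (S₀' X) ⊸ S₀' X} {e' : ∀ X → X ⊸ S₀' X}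
    {S₁'' : ∀ {A B} → A ⊸ B → S₀'' A ⊸ S₀'' B} {m'' : ∀ X → S₀'' (S₀'' X) ⊸ S₀'' X}
    {e'' : ∀ X → X ⊸ S₀'' X} {φ : ∀ X → S₀ X ⊸ S₀' X} {ψ : ∀ X → S₀' X ⊸ S₀'' X} →
    IsMonad Kleisli S₀'' S₁'' m'' e'' →
    IsKlMonadMorphism S₁' m' e' S₁'' m'' e'' ψ → IsKlMonadMorphism S₁ m e S₁' m' e' φ →
    IsKlMonadMorphism S₁ m e S₁'' m'' e'' (λ X → ψ X · φ X)
  compMorphism {S₀} {S₀'} {S₀''} {S₁} {m} {e} {S₁'} {m'} {e'} {S₁''} {m''} {e''} {φ} {ψ} S''-monad Ψ Φ = record
    { natural = λ {X} {Y} f → begin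
        (ψ Y · φ Y) · S₁ f    ≡⟨ Kl′.pullʳ (Φ.natural f) ⟩
        ψ Y · S₁' f · φ X     ≡⟨ Kl′.extendˡ (Ψ.natural f) ⟩
        S₁'' f · ψ X · φ X    ∎
    ; unit = λ X → trans (Kl′.pullʳ (Φ.unit X)) (Ψ.unit X)
    ; mult = λ X → begin
        (ψ X · φ X) · m X
          ≡⟨ Kl′.pullʳ (Φ.mult X) ⟩
        ψ X · m' X · S₁' (φ X) · φ (S₀ X)
          ≡⟨ Kl′.pullˡ (Ψ.mult X) ⟩
        (m'' X · S₁'' (ψ X) · ψ (S₀' X)) · S₁' (φ X) · φ (S₀ X)
          ≡⟨ Kl′.pullʳ (Kl′.pullʳ (Kl′.extendˡ (Ψ.natural (φ X)))) ⟩
        m'' X · S₁'' (ψ X) · S₁'' (φ X) · ψ (S₀ X) · φ (S₀ X)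
          ≡⟨ cong (m'' X ·_) (Kl′.pullˡ (sym (IsMonad.homomorphism S''-monad))) ⟩
        m'' X · S₁'' (ψ X · φ X) · ψ (S₀ X) · φ (S₀ X) ∎
    }
    where
    module Φ = IsKlMonadMorphism Φ
    module Ψ = IsKlMonadMorphism Ψ

-- Saturation: monotonicity, naturality and conjugation

module SaturationProperties {o ℓ r : Level} (C : Category o ℓ) (cp : Coproducts C) (T : Monad C)
                            (O : KleisliDefs.OrderSaturation C cp T r) where
  open Category C using (Obj; _⇒_)
  open KleisliDefs C cp T
  open OrderSaturation O
  private
    module Kl = Category Kleisli
    module Kl′ = CategoryProperties Kleisli

  hom-poset : Obj → Obj → Poset ℓ ℓ r
  hom-poset X Y = record { Carrier = X ⊸ Y ; isPartialOrder = isPartialOrder }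

  module ≤-Reasoning {X Y : Obj} = PosetReasoning (hom-poset X Y)
  module PO {X Y : Obj} = IsPartialOrder (isPartialOrder {X} {Y})

  ·-monoˡ : ∀ {X Y Z} {g g' : Y ⊸ Z} (f : X ⊸ Y) → g ≤ g' → g · f ≤ g' · f
  ·-monoˡ f = ·-mono PO.refl

  ·-monoʳ : ∀ {X Y Z} (g : Y ⊸ Z) {f f' : X ⊸ Y} → f ≤ f' → g · f ≤ g · f'
  ·-monoʳ g p = ·-mono p PO.refl

  *-mono : ∀ {X} {α β : X ⊸ X} → α ≤ β → α * ≤ β *
  *-mono {α = α} {β} p = sat-d α (β *) (sat-a β) (PO.trans p (sat-b β)) (sat-c β)

  *-idem : ∀ {X} (α : X ⊸ X) → α * * ≤ α *
  *-idem α = sat-d (α *) (α *) (sat-a α) PO.refl (sat-c α)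

  *-natural : ∀ {X Y} (f : X ⇒ Y) {α : X ⊸ X} {β : Y ⊸ Y} →
              f ♯ · α ≡ β · f ♯ → f ♯ · α * ≡ β * · f ♯
  *-natural f {α} {β} p = PO.antisym
    (sat-e≤ f α β (PO.reflexive p)) (sat-e≥ f α β (PO.reflexive (sym p)))

  -- `φ · β * · ψ` meets the three conditions of `sat-d`: the first comes from `φψ`, and in the
  -- third `ψφ` cancels the inner pair, leaving `sat-c` for `β`.
  *-conjugate : ∀ {X Y} (φ : Y ⊸ X) (ψ : X ⊸ Y) (β : Y ⊸ Y) → φ · ψ ≡ 1K → ψ · φ ≡ 1K →
                (φ · β · ψ) * ≤ φ · β * · ψ
  *-conjugate φ ψ β φψ ψφ = sat-d (φ · β · ψ) (φ · β * · ψ)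
    (begin
      1K             ≡⟨ φψ ⟨
      φ · ψ          ≡⟨ cong (φ ·_) Kl.identityˡ ⟨
      φ · 1K · ψ     ≤⟨ ·-monoʳ φ (·-monoˡ ψ (sat-a β)) ⟩
      φ · β * · ψ    ∎)
    (·-monoʳ φ (·-monoˡ ψ (sat-b β)))
    (begin
      (φ · β * · ψ) · φ · β * · ψ  ≡⟨ Kl′.pullʳ (Kl′.pullʳ (Kl′.pullˡ ψφ)) ⟩
      φ · β * · 1K · β * · ψ       ≡⟨ cong (λ z → φ · β * · z) Kl.identityˡ ⟩
      φ · β * · β * · ψ            ≡⟨ cong (φ ·_) Kl.assoc ⟨
      φ · (β * · β *) · ψ          ≤⟨ ·-monoʳ φ (·-monoˡ ψ (sat-c β)) ⟩
      φ · β * · ψ                  ∎)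
    where open ≤-Reasoning

  -- Property (e≤) for a morphism that is pure only up to an isomorphism ψ.
  *-natural-≤-up-to-iso : ∀ {X Y W} (κ : X ⇒ Y) (φ : W ⊸ Y) (ψ : Y ⊸ W) (k : X ⊸ W)
    {α : X ⊸ X} {β : W ⊸ W} → φ · ψ ≡ 1K → ψ · φ ≡ 1K → ψ · κ ♯ ≡ k →
    k · α ≤ β · k → k · α * ≤ β * · k
  *-natural-≤-up-to-iso κ φ ψ k {α} {β} φψ ψφ ψκ p = begin
    k · α *                       ≡⟨ cong (_· α *) ψκ ⟨
    (ψ · κ ♯) · α *               ≡⟨ Kl.assoc ⟩
    ψ · κ ♯ · α *                 ≤⟨ ·-monoʳ ψ (sat-e≤ κ α (φ · β · ψ) pure-step) ⟩
    ψ · (φ · β · ψ) * · κ ♯       ≤⟨ ·-monoʳ ψ (·-monoˡ (κ ♯) (*-conjugate φ ψ β φψ ψφ)) ⟩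
    ψ · (φ · β * · ψ) · κ ♯       ≡⟨ cong (ψ ·_) (Kl′.pullʳ (Kl′.pullʳ ψκ)) ⟩
    ψ · φ · β * · k               ≡⟨ Kl′.pullˡ ψφ ⟩
    1K · β * · k                  ≡⟨ Kl.identityˡ ⟩
    β * · k                       ∎
    where
    open ≤-Reasoning
    -- Inserting `φ · ψ` in front of `κ ♯` produces `k`, to which `p` applies.
    pure-step : κ ♯ · α ≤ (φ · β · ψ) · κ ♯
    pure-step = begin
      κ ♯ · α                ≡⟨ Kl.identityˡ ⟨
      1K · κ ♯ · α           ≡⟨ cong (_· κ ♯ · α) φψ ⟨
      (φ · ψ) · κ ♯ · α      ≡⟨ Kl′.pullʳ (Kl′.pullˡ ψκ) ⟩
      φ · k · α              ≤⟨ ·-monoʳ φ p ⟩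
      φ · β · k              ≡⟨ Kl′.pullʳ (Kl′.pullʳ ψκ) ⟨
      (φ · β · ψ) · κ ♯      ∎

  -- Saturation of coalgebras, covering both `_★` and `_⊛`

  module SaturatedMonad
    {S₀ : Obj → Obj} {S₁ : ∀ {A B} → A ⊸ B → S₀ A ⊸ S₀ B}
    {m : ∀ X → S₀ (S₀ X) ⊸ S₀ X} {e : ∀ X → X ⊸ S₀ X}
    (S-monad : IsMonad Kleisli S₀ S₁ m e) (S-sat : SatCompatible O S₀ S₁ m e) where
    module S = IsMonad S-monad
    open SatCompatible S-sat

    saturate : ∀ {X} → X ⊸ S₀ X → X ⊸ S₀ X
    saturate {X} α = (m X · S₁ α) * · e X

    saturate-mono : ∀ {X} {α β : X ⊸ S₀ X} → α ≤ β → saturate α ≤ saturate β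
    saturate-mono {X} p = ·-monoˡ (e X) (*-mono (·-monoʳ (m X) (locally-monotonic p)))

    -- By a unit law, `α` is its extension `m X · S₁ α` restricted along `e X`; then `sat-b`
    -- applies.
    saturate-increasing : ∀ {X} (α : X ⊸ S₀ X) → α ≤ saturate α
    saturate-increasing {X} α = begin
      α                        ≡⟨ Kl.identityˡ ⟨
      1K · α                   ≡⟨ cong (_· α) (S.unitʳ X) ⟨
      (m X · e (S₀ X)) · α     ≡⟨ Kl′.pullʳ (sym (S.η-natural α)) ⟩
      m X · S₁ α · e X         ≡⟨ Kl.assoc ⟨
      (m X · S₁ α) · e X       ≤⟨ ·-monoˡ (e X) (sat-b (m X · S₁ α)) ⟩
      saturate α               ∎
      where open ≤-Reasoning

    -- `saturation-eq` identifies the extension of `saturate α` with `(m X · S₁ α) *`, which reduces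
    -- the claim to `*-idem`.
    saturate-idem : ∀ {X} (α : X ⊸ S₀ X) → saturate (saturate α) ≤ saturate α
    saturate-idem {X} α = begin
      (m X · S₁ (saturate α)) * · e X   ≡⟨ cong (λ z → z * · e X) (saturation-eq α) ⟩
      (m X · S₁ α) * * · e X            ≤⟨ ·-monoˡ (e X) (*-idem (m X · S₁ α)) ⟩
      saturate α                        ∎
      where open ≤-Reasoning

    -- The square for `f` extends to one for `S₁ (f ♯)`. That morphism is pure by `lifted`, so both
    -- directions of property (e) apply; restricting along `e` returns to `f`.
    saturate-hom : ∀ {X Y} (f : X ⇒ Y) (Sf : S₀ X ⇒ S₀ Y) → S₁ (f ♯) ≡ Sf ♯ →
                   {α : X ⊸ S₀ X} {β : Y ⊸ S₀ Y} →
                   S₁ (f ♯) · α ≡ β · f ♯ → S₁ (f ♯) · saturate α ≡ saturate β · f ♯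
    saturate-hom {X} {Y} f Sf lifted {α} {β} p = begin
      S₁ (f ♯) · (m X · S₁ α) * · e X     ≡⟨ cong (_· (m X · S₁ α) * · e X) lifted ⟩
      Sf ♯ · (m X · S₁ α) * · e X         ≡⟨ Kl′.extendˡ (*-natural Sf free-extension-hom) ⟩
      (m Y · S₁ β) * · Sf ♯ · e X         ≡⟨ cong (λ z → (m Y · S₁ β) * · z · e X) lifted ⟨
      (m Y · S₁ β) * · S₁ (f ♯) · e X     ≡⟨ cong ((m Y · S₁ β) * ·_) (S.η-natural (f ♯)) ⟩
      (m Y · S₁ β) * · e Y · f ♯          ≡⟨ Kl.assoc ⟨
      saturate β · f ♯                    ∎
      where
      open ≡-Reasoning
      free-extension-hom : Sf ♯ · m X · S₁ α ≡ (m Y · S₁ β) · Sf ♯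
      free-extension-hom = begin
        Sf ♯ · m X · S₁ α             ≡⟨ cong (_· m X · S₁ α) lifted ⟨
        S₁ (f ♯) · m X · S₁ α         ≡⟨ Kl′.extendˡ (S.μ-natural (f ♯)) ⟩
        m Y · S₁ (S₁ (f ♯)) · S₁ α    ≡⟨ cong (m Y ·_) S.homomorphism ⟨
        m Y · S₁ (S₁ (f ♯) · α)       ≡⟨ cong (λ z → m Y · S₁ z) p ⟩
        m Y · S₁ (β · f ♯)            ≡⟨ cong (m Y ·_) S.homomorphism ⟩
        m Y · S₁ β · S₁ (f ♯)         ≡⟨ cong (λ z → m Y · S₁ β · z) lifted ⟩
        m Y · S₁ β · Sf ♯             ≡⟨ Kl.assoc ⟨
        (m Y · S₁ β) · Sf ♯           ∎

-- Comparing the two free monads over `F̄`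

module SettingProperties {o ℓ r : Level} (S : Setting o ℓ r) where
  open Setting S
  open FreeAlgebras free using (alg; unit)
  open KleisliProperties C cp T
  open SaturationProperties C cp T O
  open LiftedFreeAlgebras F̄ free
  private
    module Kl = Category Kleisli
    module Kl′ = CategoryProperties Kleisli
    module F* = IsMonad F̄*-monad
    module Free = FreeMonad kleisli-free
    module Fτ-saturated = SaturatedMonad F̄τ-monad F̄τ-sat
    module F*-saturated = SaturatedMonad F̄*-monad F̄*-sat
  open Free.Interpretation F̄*-monad ν ν-natural

  private
    -- The monad `F̄*` and the one built from free algebras share their object map, but their
    -- operations are not assumed equal. The universal property of `F̄*` supplies the comparison
    -- `φ`.
    classify = F̄*-free F*₀ Free.map Free.mult (λ X → unit X ♯) Free.isMonad
                       Free.embed Free.embed-natural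

  φ : ∀ X → F*₀ X ⊸ F*₀ X
  φ = proj₁ classify

  φ-morphism : IsKlMonadMorphism F̄*.map m e Free.map Free.mult (λ X → unit X ♯) φ
  φ-morphism = proj₁ (proj₂ classify)

  φ-ν : ∀ X → φ X · ν X ≡ Free.embed X
  φ-ν = proj₁ (proj₂ (proj₂ classify))

  ⟦⟧-morphism : IsKlMonadMorphism Free.map Free.mult (λ X → unit X ♯) F̄*.map m e ⟦_⟧
  ⟦⟧-morphism = record { natural = ⟦⟧-natural ; unit = ⟦⟧-unit ; mult = ⟦⟧-mult }

  -- Both sides are monad endomorphisms of `F̄*` carrying `ν` to `ν`, and the universal property
  -- allows only one.
  ⟦⟧-φ : ∀ X → ⟦ X ⟧ · φ X ≡ 1K
  ⟦⟧-φ X = trans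
    (unique-morphism _ (compMorphism F̄*-monad ⟦⟧-morphism φ-morphism)
      (λ Y → trans (Kl′.pullʳ (φ-ν Y)) (⟦⟧-embed Y)) X)
    (sym (unique-morphism _ (idMorphism F̄*-monad) (λ Y → Kl.identityˡ) X))
    where
    unique-morphism = proj₂ (proj₂ (proj₂ (F̄*-free F*₀ F̄*.map m e F̄*-monad ν ν-natural)))

  -- Here uniqueness comes from the free algebra: `φ X` is a homomorphism from `action X` to
  -- `alg X ♯`, so the composite is the extension of `unit X ♯`, which is the identity.
  φ-⟦⟧ : ∀ X → φ X · ⟦ X ⟧ ≡ 1K
  φ-⟦⟧ X = begin
    φ X · ⟦ X ⟧                         ≡⟨ Free.extend-fusion (φ X) φ-hom ⟩
    FA.extend (alg X ♯) (φ X · e X)     ≡⟨ cong (FA.extend (alg X ♯)) (Φ.unit X) ⟩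
    FA.extend (alg X ♯) (unit X ♯)      ≡⟨ Free.extend-alg-unit X ⟩
    1K                                  ∎
    where
    open ≡-Reasoning
    module FA = FreeAlgebraStructure kleisli-free
    module Φ = IsKlMonadMorphism φ-morphism
    φ-hom : φ X · action X ≡ alg X ♯ · F̄.map (φ X)
    φ-hom = begin
      φ X · m X · ν (F*₀ X)
        ≡⟨ Kl′.pullˡ (Φ.mult X) ⟩
      (Free.mult X · Free.map (φ X) · φ (F*₀ X)) · ν (F*₀ X)
        ≡⟨ Kl′.pullʳ (Kl′.pullʳ (φ-ν (F*₀ X))) ⟩
      Free.mult X · Free.map (φ X) · Free.embed (F*₀ X)
        ≡⟨ cong (Free.mult X ·_) (Free.embed-natural (φ X)) ⟩
      Free.mult X · Free.embed (F*₀ X) · F̄.map (φ X)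
        ≡⟨ Kl′.pullˡ (Free.mult-embed X) ⟩
      alg X ♯ · F̄.map (φ X) ∎

  -- Passing from `F̄τ` to `F̄*`

  inclusion : ∀ X → Fτ₀ X ⊸ F*₀ X
  inclusion X = [ ν X , e X ]K

  -- Built in `C` from the free algebras, so that property (e) is available for `κ X ♯`.
  κ : ∀ X → Fτ₀ X ⇒ F*₀ X
  κ X = [ alg X ∘ F₁ (unit X) , unit X ]

  ⟦⟧-κ : ∀ X → ⟦ X ⟧ · κ X ♯ ≡ inclusion X
  ⟦⟧-κ X = begin
    ⟦ X ⟧ · κ X ♯                                ≡⟨ ·-♯ _ _ ⟩
    ⟦ X ⟧ ∘ κ X                                  ≡⟨ unique left right ⟨
    inclusion X                                  ∎
    where
    open ≡-Reasoning
    embed-pure : (alg X ∘ F₁ (unit X)) ♯ ≡ Free.embed X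
    embed-pure = begin
      (alg X ∘ F₁ (unit X)) ♯        ≡⟨ assoc ⟨
      alg X ♯ ∘ F₁ (unit X)          ≡⟨ ·-♯ _ _ ⟨
      alg X ♯ · F₁ (unit X) ♯        ≡⟨ cong (alg X ♯ ·_) (F̄.lifts (unit X)) ⟨
      Free.embed X                   ∎
    left : (⟦ X ⟧ ∘ κ X) ∘ i₁ ≡ ν X
    left = begin
      (⟦ X ⟧ ∘ κ X) ∘ i₁                   ≡⟨ CategoryProperties.pullʳ C inject₁ ⟩
      ⟦ X ⟧ ∘ alg X ∘ F₁ (unit X)          ≡⟨ ·-♯ _ _ ⟨
      ⟦ X ⟧ · (alg X ∘ F₁ (unit X)) ♯      ≡⟨ cong (⟦ X ⟧ ·_) embed-pure ⟩
      ⟦ X ⟧ · Free.embed X                 ≡⟨ ⟦⟧-embed X ⟩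
      ν X                                  ∎
    right : (⟦ X ⟧ ∘ κ X) ∘ i₂ ≡ e X
    right = begin
      (⟦ X ⟧ ∘ κ X) ∘ i₂    ≡⟨ CategoryProperties.pullʳ C inject₂ ⟩
      ⟦ X ⟧ ∘ unit X        ≡⟨ ·-♯ _ _ ⟨
      ⟦ X ⟧ · unit X ♯      ≡⟨ ⟦⟧-unit X ⟩
      e X                   ∎

  inclusion-natural : ∀ {X Y} (f : X ⊸ Y) → inclusion Y · F̄τ₁ f ≡ F̄*.map f · inclusion X
  inclusion-natural {X} {Y} f = begin
    inclusion Y · (F̄.map f ⊕ f)              ≡⟨ cotuple-⊕ _ _ _ _ ⟩
    [ ν Y · F̄.map f , e Y · f ]              ≡⟨ cong₂ [_,_] (ν-natural f) (F*.η-natural f) ⟨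
    [ F̄*.map f · ν X , F̄*.map f · e X ]      ≡⟨ ·-cotuple _ _ _ ⟨
    F̄*.map f · inclusion X                   ∎
    where open ≡-Reasoning

  F̄τ-lifts : ∀ {X Y} (f : X ⇒ Y) → F̄τ₁ (f ♯) ≡ (F₁ f +₁ f) ♯
  F̄τ-lifts f = trans (cong (_⊕ (f ♯)) (F̄.lifts f)) (♯-⊕-♯ (F₁ f) f)

  under-hom : ∀ {X Y} (f : X ⇒ Y) {α : X ⊸ Fτ₀ X} {γ : Y ⊸ Fτ₀ Y} →
              IsCoalgHom C TFτ₀ TFτ₁ α γ f → F̄*.map (f ♯) · under α ≡ under γ · f ♯
  under-hom {X} {Y} f {α} {γ} p = begin
    F̄*.map (f ♯) · inclusion X · α     ≡⟨ Kl′.extendˡ (inclusion-natural (f ♯)) ⟨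
    inclusion Y · F̄τ₁ (f ♯) · α        ≡⟨ cong (λ z → inclusion Y · z · α) (F̄τ-lifts f) ⟩
    inclusion Y · (F₁ f +₁ f) ♯ · α    ≡⟨ cong (inclusion Y ·_) (♯-· (F₁ f +₁ f) α) ⟩
    inclusion Y · TFτ₁ f ∘ α           ≡⟨ cong (inclusion Y ·_) p ⟩
    inclusion Y · γ ∘ f                ≡⟨ cong (inclusion Y ·_) (·-♯ γ f) ⟨
    inclusion Y · γ · f ♯              ≡⟨ Kl.assoc ⟨
    under γ · f ♯                      ∎
    where open ≡-Reasoning

  ⊛-hom : ∀ {X Y} (f : X ⇒ Y) {α : X ⊸ F*₀ X} {γ : Y ⊸ F*₀ Y} →
          F̄*.map (f ♯) · α ≡ γ · f ♯ → IsCoalgHom C TF*₀ TF*₁ (α ⊛) (γ ⊛) f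
  ⊛-hom f {α} {γ} p = begin
    TF*₁ f ∘ α ⊛           ≡⟨ ♯-· (F*₁ f) (α ⊛) ⟨
    F*₁ f ♯ · α ⊛          ≡⟨ cong (_· α ⊛) (F̄*.lifts f) ⟨
    F̄*.map (f ♯) · α ⊛     ≡⟨ F*-saturated.saturate-hom f (F*₁ f) (F̄*.lifts f) p ⟩
    γ ⊛ · f ♯              ≡⟨ ·-♯ (γ ⊛) f ⟩
    γ ⊛ ∘ f                ∎
    where open ≡-Reasoning

  module _ {X : Obj} (α : X ⊸ Fτ₀ X)
           (hyp : inclusion X · m' X · F̄τ₁ α ≤ m X · F̄*.map (under α) · inclusion X) where

    -- `inclusion-*` passes `hyp` on to the saturations; composing with `e'` then selects the
    -- component `e X` of `inclusion X`.
    under-★-≤ : under (α ★) ≤ under α ⊛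
    under-★-≤ = begin
      inclusion X · A * · e' X       ≡⟨ Kl.assoc ⟨
      (inclusion X · A *) · e' X     ≤⟨ ·-monoˡ (e' X) inclusion-* ⟩
      (B * · inclusion X) · e' X     ≡⟨ Kl′.pullʳ (cotuple-ι² (ν X) (e X)) ⟩
      under α ⊛                      ∎
      where
      open ≤-Reasoning
      A = m' X · F̄τ₁ α
      B = m X · F̄*.map (under α)
      inclusion-* : inclusion X · A * ≤ B * · inclusion X
      inclusion-* = *-natural-≤-up-to-iso (κ X) (φ X) ⟦ X ⟧ (inclusion X)
        (φ-⟦⟧ X) (⟦⟧-φ X) (⟦⟧-κ X) (PO.trans hyp (PO.reflexive (sym Kl.assoc)))

    -- One direction applies monotonicity and idempotence of `_⊛` to `under-★-≤`; the other uses
    -- `α ≤ α ★` and monotonicity.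
    under-★-⊛ : under (α ★) ⊛ ≡ under α ⊛
    under-★-⊛ = PO.antisym
      (PO.trans (F*-saturated.saturate-mono under-★-≤) (F*-saturated.saturate-idem (under α)))
      (F*-saturated.saturate-mono (·-monoʳ (inclusion X) (Fτ-saturated.saturate-increasing α)))

    ⊛-hom-from-★ : ∀ {Y} (f : X ⇒ Y) {γ : Y ⊸ Fτ₀ Y} → IsCoalgHom C TFτ₀ TFτ₁ (α ★) γ f →
                   IsCoalgHom C TF*₀ TF*₁ (under α ⊛) (under γ ⊛) f
    ⊛-hom-from-★ f {γ} p = subst (λ β → IsCoalgHom C TF*₀ TF*₁ β (under γ ⊛) f) under-★-⊛
      (⊛-hom f (under-hom f p))

theorem7 : ∀ {o ℓ r : Level} (S : Setting o ℓ r) →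
    let open Setting S in
    ∀ (X : Obj) (α : X ⊸ Fτ₀ X) →
    [ ν X , e X ]K · m' X · F̄τ₁ α ≤ m X · F̄*.map (under α) · [ ν X , e X ]K →
    ∀ (R : Obj) (π₁ π₂ : R ⇒ X) →
    IsBisimulation C TFτ₀ TFτ₁ (α ★) (α ★) π₁ π₂ →
    IsBisimulation C TF*₀ TF*₁ (under α ⊛) (under α ⊛) π₁ π₂
theorem7 S X α hyp R π₁ π₂ (monic , Y , γ , f , g , f-hom , g-hom , pullback) =
  -- The cospan `f`, `g` and its pullback are kept; only the structure on the vertex `Y` changes,
  -- from `γ` to `under γ ⊛`.
  monic , Y , Setting._⊛ S (Setting.under S γ) , f , g ,
  ⊛-hom-from-★ α hyp f f-hom , ⊛-hom-from-★ α hyp g g-hom , pullback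
  where open SettingProperties S
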